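{- $\langle\forall\forall^\infty\forall\rangle\not\le_{\sf m}\langle\exists^\infty\forall\rangle$.
   Context: Quantifiers range over $\omega$. $\exists^\infty n\,\varphi(n)$ means $\forall m\exists n\ge m\,\varphi(n)$ and $\forall^\infty n\,\varphi(n)$ means $\exists m\forall n\ge m\,\varphi(n)$. A quantifier-pattern is a finite string $\bar{\mathsf Q}=\mathsf Q_0\dots\mathsf Q_\ell$ over $\{\exists,\forall,\exists^\infty,\forall^\infty\}$. A $\bar{\mathsf Q}$-formula is $\varphi(\bar x)\equiv\mathsf Q_0n_0\dots\mathsf Q_\ell n_\ell\,\theta(n_0,\dots,n_\ell,\bar x)$ with $\theta$ bounded. The instance $\bar x$ is a tuple of natural numbers and/or total computable functions (computable elements of $\omega^\omega$). Spaces such as $\omega\times\omega^\omega$, $(\omega^\omega)^\omega$, $\omega^{\omega\times\omega}$ are identified with $\omega^\omega$ by computable pairing. Witnesses: for $\alpha\in\omega^\omega$, $\alpha\Vdash\varphi(\bar x)$ ("$\alpha$ is a witness for $\varphi(\bar x)$") is defined by: $\alpha\Vdash\theta(\bar x)$ iff $\alpha=\bar x$ and $\theta(\bar x)$, for bounded $\theta$; $\langle t,\alpha\rangle\Vdash\exists n\varphi(n,\bar x)$ iff $\alpha\Vdash\varphi(t,\bar x)$; $\alpha\Vdash\forall n\varphi(n,\bar x)$ iff $\alpha(n)\Vdash\varphi(n,\bar x)$ for all $n$; $\langle t,\alpha\rangle\Vdash\forall^\infty n\varphi(n,\bar x)$ iff $\alpha(n)\Vdash\varphi(n,\bar x)$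 for all $n\ge t$; $\alpha\Vdash\exists^\infty n\varphi(n,\bar x)$ iff for all $n$, writing $\alpha(n)=\langle k,\beta\rangle$, $k\ge n$ and $\beta\Vdash\varphi(k,\bar x)$. $\varphi\le_{\sf m}\psi$ if there are computable functions $\eta,r_-,r_+$ (type-two computable functionals, possibly partial but defined wherever required) such that for every instance $\bar x$: $\varphi(\bar x)$ is true iff $\psi(\eta(\bar x))$ is true; $\alpha\Vdash\varphi(\bar x)$ implies $r_-(\alpha,\bar x)\Vdash\psi(\eta(\bar x))$; $\alpha\Vdash\psi(\eta(\bar x))$ implies $r_+(\alpha,\bar x)\Vdash\varphi(\bar x)$ ($\alpha\in\omega^\omega$ arbitrary). $\langle\bar{\mathsf Q}\rangle$ denotes a fixed $\bar{\mathsf Q}$-formula to which every $\bar{\mathsf Q}$-formula is $\le_{\sf m}$-reducible; concretely $\langle\bar{\mathsf Q}\rangle(x)\equiv\mathsf Q_0n_0\dots\mathsf Q_\ell n_\ell.\ x(n_0,\dots,n_\ell)=0$ (the choice does not matter up to $\equiv_{\sf m}$). -}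

module Defs where

open import Data.Fin using (Fin)
open import Data.List using (List; []; _∷_)
open import Data.Nat using (ℕ; zero; suc; _+_; _≥_; _<_)
open import Data.Product using (_×_; ∃; ∃-syntax)
open import Data.Vec using (Vec; []; _∷_; _∷ʳ_; lookup)
open import Function.Bundles using (_⇔_)
open import Relation.Binary.PropositionalEquality using (_≡_; _≗_)

Baire : Set
Baire = ℕ → ℕ

-- ω × ω^ω is identified with ω^ω by prefixing: α is the pair ⟨ head α , tail α ⟩.

head : Baire → ℕ
head α = α 0

tail : Baire → Baire
tail α i = α (suc i)

infixr 5 _++ˢ_

_++ˢ_ : ∀ {n} → Vec ℕ n → Baire → Baire
([]       ++ˢ x) i       = x i
((n ∷ ns) ++ˢ x) zero    = n
((n ∷ ns) ++ˢ x) (suc i) = (ns ++ˢ x) i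

triangle : ℕ → ℕ
triangle zero    = 0
triangle (suc k) = suc k + triangle k

-- Cantor's bijection ω × ω → ω; it identifies (ω^ω)^ω with ω^ω via row.
pair : ℕ → ℕ → ℕ
pair m n = triangle (m + n) + n

row : Baire → ℕ → Baire
row α n i = α (pair n i)

tuple : ∀ {n} → Vec ℕ n → ℕ
tuple []           = 0
tuple (m ∷ [])     = m
tuple (m ∷ n ∷ ns) = pair m (tuple (n ∷ ns))

-- Type-two computability: μ-recursive programs that may query o oracles.
-- Code o n is the type of programs for partial functions ω^n ⇀ ω.

data Code (o : ℕ) : ℕ → Set where
  zeroᶜ  : ∀ {n} → Code o n
  sucᶜ   : Code o 1
  proj   : ∀ {n} → Fin n → Code o n
  oracle : Fin o → Code o 1
  comp   : ∀ {m n} → Code o m → Vec (Code o n) m → Code o n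
  prec   : ∀ {n} → Code o n → Code o (2 + n) → Code o (1 + n)
  mu     : ∀ {n} → Code o (1 + n) → Code o n

-- O ⊢ c ∙ xs ⇓ y : with oracles O, the program c on input xs halts with value y.

infix 4 _⊢_∙_⇓_ _⊢_∙_⇓*_

mutual
  data _⊢_∙_⇓_ {o} (O : Vec Baire o) : ∀ {n} → Code o n → Vec ℕ n → ℕ → Set where
    ⇓zero   : ∀ {n} {xs : Vec ℕ n} → O ⊢ zeroᶜ ∙ xs ⇓ 0
    ⇓suc    : ∀ {x} → O ⊢ sucᶜ ∙ x ∷ [] ⇓ suc x
    ⇓proj   : ∀ {n} {i : Fin n} {xs} → O ⊢ proj i ∙ xs ⇓ lookup xs i
    ⇓oracle : ∀ {i x} → O ⊢ oracle i ∙ x ∷ [] ⇓ lookup O i x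
    ⇓comp   : ∀ {m n} {f : Code o m} {gs : Vec (Code o n) m} {xs ys z} →
              O ⊢ gs ∙ xs ⇓* ys → O ⊢ f ∙ ys ⇓ z → O ⊢ comp f gs ∙ xs ⇓ z
    ⇓prec₀  : ∀ {n} {f : Code o n} {g xs y} →
              O ⊢ f ∙ xs ⇓ y → O ⊢ prec f g ∙ zero ∷ xs ⇓ y
    ⇓precₛ  : ∀ {n} {f : Code o n} {g xs k y z} →
              O ⊢ prec f g ∙ k ∷ xs ⇓ y → O ⊢ g ∙ k ∷ y ∷ xs ⇓ z →
              O ⊢ prec f g ∙ suc k ∷ xs ⇓ z
    ⇓mu     : ∀ {n} {f : Code o (1 + n)} {xs y} →
              O ⊢ f ∙ y ∷ xs ⇓ 0 →
              (∀ k → k < y → ∃[ v ] O ⊢ f ∙ k ∷ xs ⇓ suc v) →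
              O ⊢ mu f ∙ xs ⇓ y

  data _⊢_∙_⇓*_ {o} (O : Vec Baire o) {n} :
       ∀ {m} → Vec (Code o n) m → Vec ℕ n → Vec ℕ m → Set where
    ⇓[] : ∀ {xs} → O ⊢ [] ∙ xs ⇓* []
    ⇓∷  : ∀ {m} {g : Code o n} {gs : Vec (Code o n) m} {xs y ys} →
          O ⊢ g ∙ xs ⇓ y → O ⊢ gs ∙ xs ⇓* ys → O ⊢ g ∷ gs ∙ xs ⇓* y ∷ ys

-- c ⟨ O ⟩≃ β : the partial functional (ω^ω)^o ⇀ ω^ω computed by c is defined
-- at O, with value β.

infix 4 _⟨_⟩≃_

_⟨_⟩≃_ : ∀ {o} → Code o 1 → Vec Baire o → Baire → Set
c ⟨ O ⟩≃ β = ∀ i → O ⊢ c ∙ i ∷ [] ⇓ β i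

Computable : Baire → Set
Computable x = ∃[ c ] c ⟨ [] ⟩≃ x

data Quantifier : Set where
  ∃′ ∀′ ∃^∞ ∀^∞ : Quantifier

-- Formula n: formulas with n free number variables and a parameter x ∈ ω^ω.
-- Quantifier-free matrices are given semantically; the only one used
-- is the equation in ⟨ Qs ⟩ below.  A quantifier binds the last number variable.

data Formula (n : ℕ) : Set₁ where
  matrix : (Vec ℕ n → Baire → Set) → Formula n
  quant  : Quantifier → Formula (suc n) → Formula n

True : ∀ {n} → Formula n → Vec ℕ n → Baire → Set
True (matrix θ)    ns x = θ ns x
True (quant ∃′  φ) ns x = ∃[ k ] True φ (ns ∷ʳ k) x
True (quant ∀′  φ) ns x = ∀ k → True φ (ns ∷ʳ k) x
True (quant ∃^∞ φ) ns x = ∀ m → ∃[ k ] k ≥ m × True φ (ns ∷ʳ k) x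
True (quant ∀^∞ φ) ns x = ∃[ m ] (∀ k → k ≥ m → True φ (ns ∷ʳ k) x)

-- Witness φ ns x α : α ⊩ φ(ns , x).

Witness : ∀ {n} → Formula n → Vec ℕ n → Baire → Baire → Set
Witness (matrix θ)    ns x α = α ≗ ns ++ˢ x × θ ns x
Witness (quant ∃′  φ) ns x α = Witness φ (ns ∷ʳ head α) x (tail α)
Witness (quant ∀′  φ) ns x α = ∀ k → Witness φ (ns ∷ʳ k) x (row α k)
Witness (quant ∃^∞ φ) ns x α =
  ∀ m → head (row α m) ≥ m ×
        Witness φ (ns ∷ʳ head (row α m)) x (tail (row α m))
Witness (quant ∀^∞ φ) ns x α =
  ∀ k → k ≥ head α → Witness φ (ns ∷ʳ k) x (row (tail α) k)

quantify : List Quantifier → ∀ {n} → Formula n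
quantify []       = matrix λ ns x → x (tuple ns) ≡ 0
quantify (Q ∷ Qs) = quant Q (quantify Qs)

-- ⟨ Q₀ ∷ … ∷ Qₗ ∷ [] ⟩ is the formula Q₀ n₀ … Qₗ nₗ. x (n₀ , … , nₗ) = 0.
⟨_⟩ : List Quantifier → Formula 0
⟨ Qs ⟩ = quantify Qs

-- Instances are the computable x, while witnesses α are arbitrary.

infix 4 _≤ₘ_

record _≤ₘ_ (φ ψ : Formula 0) : Set where
  field
    η       : Code 1 1
    r₋ r₊   : Code 2 1
    reduces : ∀ x → Computable x →
      ∃[ y ] η ⟨ x ∷ [] ⟩≃ y
           × (True φ [] x ⇔ True ψ [] y)
           × (∀ α → Witness φ [] x α →
                ∃[ β ] r₋ ⟨ α ∷ x ∷ [] ⟩≃ β × Witness ψ [] y β)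
           × (∀ α → Witness ψ [] y α →
                ∃[ β ] r₊ ⟨ α ∷ x ∷ [] ⟩≃ β × Witness φ [] x β)

{-# OPTIONS --safe #-}
-- Write K(y) for the set of k with y(k,b) = 0 for all b. Only the zero instance
-- and the instances δ p with a single nonzero entry are needed.
-- Call k good for σ = (σ₀,…,σₙ₋₁) if k ∈ K(η 0) and, for every N, k ∈ K(η(δ p))
-- for all late enough p = (a,c,b) whose column c is below σₐ (a < n) or N (a ≥ n).
-- (1) For each n, only finitely many k are good for some σ of length n: infinitely
--     many of them would form a witness for η 0, from which r₊ computes a threshold u
--     for row n using finitely many k; a late nonzero entry in column u of row n
--     keeps all these k in K but refutes u.
-- (2) If no k ≥ m is good for σ then, for some x, no k ≥ m is good for (σ,x):
--     by (1) only finitely many k matter, and each of them fails for all large x.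
-- (3) By (1) no k ≥ m is good for the empty sequence, for some m; iterating (2)
--     yields thresholds t such that no k ≥ m is good for any initial segment of t.
--     But r₋ turns t, as a witness for the zero instance, into some k ≥ m after
--     reading finitely much of t, and then k is good for an initial segment of t.
module Submission where

open import Defs
open import Axiom.ExcludedMiddle using (ExcludedMiddle)
open import Data.Empty using (⊥)
open import Data.Fin using (zero; suc)
open import Data.List using (_∷_; [])
open import Data.Nat
open import Data.Nat.Properties
open import Data.Product using (_×_; _,_; ∃-syntax; proj₁; proj₂; uncurry)
open import Data.Product.Properties using (,-injective)
open import Data.Sum using (inj₁; inj₂; [_,_]′)
open import Data.Vec using (Vec; []; _∷_; _∷ʳ_; lookup)
open import Function.Base using (const; _∘_)
open import Level using (0ℓ)
open import Relation.Binary.Definitions using (tri<; tri≈; tri>)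
open import Relation.Binary.PropositionalEquality
open import Relation.Nullary using (¬_; yes; no; contradiction)
open import Relation.Nullary.Decidable using (decidable-stable)

-- Eventual properties of natural numbers

Eventually : (ℕ → Set) → Set
Eventually P = ∃[ l ] (∀ p → l ≤ p → P p)

eventually-map : ∀ {P Q : ℕ → Set} → (∀ {p} → P p → Q p) → Eventually P → Eventually Q
eventually-map f (l , h) = l , λ p l≤p → f (h p l≤p)

eventually-zip : ∀ {P Q R : ℕ → Set} → (∀ {p} → P p → Q p → R p) →
                 Eventually P → Eventually Q → Eventually R
eventually-zip f (l , h) (l′ , h′) =
  l ⊔ l′ , λ p q → f (h p (≤-trans (m≤m⊔n l l′) q)) (h′ p (≤-trans (m≤n⊔m l l′) q))

eventually-∀< : ∀ {P : ℕ → ℕ → Set} n → (∀ k → k < n → Eventually (P k)) →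
                Eventually (λ p → ∀ k → k < n → P k p)
eventually-∀< zero    h = 0 , λ _ _ _ ()
eventually-∀< {P} (suc n) h =
  eventually-zip combine (h n ≤-refl) (eventually-∀< n λ k k<n → h k (m≤n⇒m≤1+n k<n))
  where
  combine : ∀ {p} → P n p → (∀ k → k < n → P k p) → ∀ k → k < suc n → P k p
  combine top below k k<1+n with m≤n⇒m<n∨m≡n (s≤s⁻¹ k<1+n)
  ... | inj₁ k<n  = below k k<n
  ... | inj₂ refl = top

-- Determinism and continuity of type-two computations

mutual
  ⇓-deterministic : ∀ {o} {O : Vec Baire o} {n} {c : Code o n} {xs y y′} →
                    O ⊢ c ∙ xs ⇓ y → O ⊢ c ∙ xs ⇓ y′ → y ≡ y′
  ⇓-deterministic ⇓zero ⇓zero = refl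
  ⇓-deterministic ⇓suc ⇓suc = refl
  ⇓-deterministic ⇓proj ⇓proj = refl
  ⇓-deterministic ⇓oracle ⇓oracle = refl
  ⇓-deterministic (⇓comp ds d) (⇓comp ds′ d′) with refl ← ⇓*-deterministic ds ds′ =
    ⇓-deterministic d d′
  ⇓-deterministic (⇓prec₀ d) (⇓prec₀ d′) = ⇓-deterministic d d′
  ⇓-deterministic (⇓precₛ d e) (⇓precₛ d′ e′) with refl ← ⇓-deterministic d d′ =
    ⇓-deterministic e e′
  ⇓-deterministic (⇓mu {y = y} d h) (⇓mu {y = y′} d′ h′) with <-cmp y y′
  ... | tri≈ _ y≡y′ _ = y≡y′
  ... | tri< y<y′ _ _ = contradiction (⇓-deterministic d (proj₂ (h′ y y<y′))) λ ()
  ... | tri> _ _ y′<y with h y′ y′<y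
  ...   | _ , e = contradiction (⇓-deterministic e d′) λ ()

  ⇓*-deterministic : ∀ {o} {O : Vec Baire o} {m n} {cs : Vec (Code o n) m} {xs ys ys′} →
                     O ⊢ cs ∙ xs ⇓* ys → O ⊢ cs ∙ xs ⇓* ys′ → ys ≡ ys′
  ⇓*-deterministic ⇓[] ⇓[] = refl
  ⇓*-deterministic (⇓∷ d ds) (⇓∷ d′ ds′) =
    cong₂ _∷_ (⇓-deterministic d d′) (⇓*-deterministic ds ds′)

Agree : ℕ → Baire → Baire → Set
Agree l f g = ∀ i → i < l → f i ≡ g i

data AgreeAll (l : ℕ) : ∀ {o} → Vec Baire o → Vec Baire o → Set where
  []  : AgreeAll l [] []
  _∷_ : ∀ {o f g} {O O′ : Vec Baire o} →
        Agree l f g → AgreeAll l O O′ → AgreeAll l (f ∷ O) (g ∷ O′)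

agree-lookup : ∀ {l o} {O O′ : Vec Baire o} → AgreeAll l O O′ →
               ∀ i → Agree l (lookup O i) (lookup O′ i)
agree-lookup (a ∷ _)  zero    = a
agree-lookup (_ ∷ as) (suc i) = agree-lookup as i

mutual
  -- A halting computation makes finitely many oracle queries, so any `l` above all queried
  -- positions works.
  ⇓-continuous : ∀ {o} {O : Vec Baire o} {n} {c : Code o n} {xs y} → O ⊢ c ∙ xs ⇓ y →
                 Eventually (λ l → ∀ O′ → AgreeAll l O O′ → O′ ⊢ c ∙ xs ⇓ y)
  ⇓-continuous ⇓zero = 0 , λ _ _ _ _ → ⇓zero
  ⇓-continuous ⇓suc  = 0 , λ _ _ _ _ → ⇓suc
  ⇓-continuous ⇓proj = 0 , λ _ _ _ _ → ⇓proj
  ⇓-continuous (⇓oracle {i} {x}) =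
    suc x , λ l x<l O′ as → subst (_ ⊢ oracle i ∙ x ∷ [] ⇓_) (sym (agree-lookup as i x x<l)) ⇓oracle
  ⇓-continuous (⇓comp ds d) =
    eventually-zip (λ p q O′ as → ⇓comp (p O′ as) (q O′ as)) (⇓*-continuous ds) (⇓-continuous d)
  ⇓-continuous (⇓prec₀ d) = eventually-map (λ p O′ as → ⇓prec₀ (p O′ as)) (⇓-continuous d)
  ⇓-continuous (⇓precₛ d e) =
    eventually-zip (λ p q O′ as → ⇓precₛ (p O′ as) (q O′ as)) (⇓-continuous d) (⇓-continuous e)
  ⇓-continuous (⇓mu {y = y} d h) =
    -- The search visits only the finitely many failing `k < y` before `y`, so finitely many bounds
    -- are combined.
    eventually-zip (λ p q O′ as → ⇓mu (p O′ as) (λ k k<y → q k k<y O′ as)) (⇓-continuous d)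
      (eventually-∀< y λ k k<y → ∃⇓-continuous (h k k<y))

  ∃⇓-continuous : ∀ {o} {O : Vec Baire o} {n} {c : Code o n} {xs} →
                  ∃[ v ] O ⊢ c ∙ xs ⇓ suc v →
                  Eventually (λ l → ∀ O′ → AgreeAll l O O′ → ∃[ v ] O′ ⊢ c ∙ xs ⇓ suc v)
  ∃⇓-continuous (v , d) = eventually-map (λ p O′ as → v , p O′ as) (⇓-continuous d)

  ⇓*-continuous : ∀ {o} {O : Vec Baire o} {m n} {cs : Vec (Code o n) m} {xs ys} →
                  O ⊢ cs ∙ xs ⇓* ys →
                  Eventually (λ l → ∀ O′ → AgreeAll l O O′ → O′ ⊢ cs ∙ xs ⇓* ys)
  ⇓*-continuous ⇓[] = 0 , λ _ _ _ _ → ⇓[]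
  ⇓*-continuous (⇓∷ d ds) =
    eventually-zip (λ p q O′ as → ⇓∷ (p O′ as) (q O′ as)) (⇓-continuous d) (⇓*-continuous ds)

≃-continuous : ∀ {o} {c : Code o 1} {O β} → c ⟨ O ⟩≃ β → ∀ i →
               Eventually (λ l → ∀ O′ {β′} → AgreeAll l O O′ → c ⟨ O′ ⟩≃ β′ → β i ≡ β′ i)
≃-continuous d i =
  eventually-map (λ p O′ {β′} as d′ → ⇓-deterministic (p O′ as) (d′ i)) (⇓-continuous (d i))

-- Cantor pairing

nextPair : ℕ × ℕ → ℕ × ℕ
nextPair (zero  , n) = suc n , 0
nextPair (suc m , n) = m , suc n

unpair : ℕ → ℕ × ℕ
unpair zero    = 0 , 0
unpair (suc z) = nextPair (unpair z)

pair-suc : ∀ m n → pair m (suc n) ≡ suc (pair (suc m) n)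
pair-suc m n = trans (cong (λ s → triangle s + suc n) (+-suc m n)) (+-suc _ n)

pair-zero : ∀ m → pair (suc m) 0 ≡ suc (pair 0 m)
pair-zero m = trans (+-identityʳ _)
  (trans (cong (λ s → suc s + triangle s) (+-identityʳ m)) (cong suc (+-comm m _)))

unpair-pair : ∀ m n → unpair (pair m n) ≡ (m , n)
unpair-pair m n = go (m + n) m n refl
  where
  -- Recursion on `(s , n)` in lexicographic order: walk back along the antidiagonal until `n` is
  -- zero, then pass to the previous one.
  go : ∀ s m n → m + n ≡ s → unpair (pair m n) ≡ (m , n)
  go _       zero    zero    _ = refl
  go (suc s) (suc m) zero    e = trans (cong unpair (pair-zero m))
    (cong nextPair (go s 0 m (trans (sym (+-identityʳ m)) (suc-injective e))))
  go s       m       (suc n) e = trans (cong unpair (pair-suc m n))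
    (cong nextPair (go s (suc m) n (trans (sym (+-suc m n)) e)))

pair-injective : ∀ m n m′ n′ → pair m n ≡ pair m′ n′ → m ≡ m′ × n ≡ n′
pair-injective m n m′ n′ e =
  ,-injective (trans (sym (unpair-pair m n)) (trans (cong unpair e) (unpair-pair m′ n′)))

unpair-≤ : ∀ z → proj₁ (unpair z) + proj₂ (unpair z) ≤ z
unpair-≤ zero    = z≤n
unpair-≤ (suc z) with unpair z | unpair-≤ z
... | zero  , n | le = s≤s (≤-trans (≤-reflexive (+-identityʳ n)) le)
... | suc m , n | le = m≤n⇒m≤1+n (≤-trans (≤-reflexive (+-suc m n)) le)

join : (ℕ → Baire) → Baire
join f z = uncurry f (unpair z)

row-join : ∀ f n → row (join f) n ≗ f n
row-join f n i = cong (uncurry f) (unpair-pair n i)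

-- Both coordinates of a pair are at most its code, so below `l` only rows and positions below `l`
-- are read.
join-agree : ∀ {l f g} → (∀ n → n < l → Agree l (f n) (g n)) → Agree l (join f) (join g)
join-agree h z z<l =
  h _ (≤-<-trans (≤-trans (m≤m+n _ _) (unpair-≤ z)) z<l)
    _ (≤-<-trans (≤-trans (m≤n+m _ _) (unpair-≤ z)) z<l)

++ˢ-agree : ∀ {l n} (ns : Vec ℕ n) {x y} → Agree l x y → Agree l (ns ++ˢ x) (ns ++ˢ y)
++ˢ-agree []       h i       i<l = h i i<l
++ˢ-agree (_ ∷ ns) h zero    i<l = refl
++ˢ-agree (_ ∷ ns) h (suc i) i<l = ++ˢ-agree ns h i (<⇒≤ i<l)

cons-agree : ∀ {l m n x y} → m ≡ n → Agree l x y → Agree l ((m ∷ []) ++ˢ x) ((n ∷ []) ++ˢ y)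
cons-agree m≡n h zero    i<l = m≡n
cons-agree m≡n h (suc i) i<l = h i (<⇒≤ i<l)

-- Canonical witnesses

Φ Ψ : Formula 0
Φ = ⟨ ∀′ ∷ ∀^∞ ∷ ∀′ ∷ [] ⟩
Ψ = ⟨ ∃^∞ ∷ ∀′ ∷ [] ⟩

position : ℕ → ℕ → ℕ → ℕ
position a c b = tuple (a ∷ c ∷ b ∷ [])

Thresholds : Baire → Baire → Set
Thresholds x t = ∀ n k b → t n ≤ k → x (position n k b) ≡ 0

block : ∀ {n} → Vec ℕ n → Baire → ℕ → Baire
block ns x b = (ns ∷ʳ b) ++ˢ x

column : ℕ → Baire → ℕ → Baire
column n x k = join (block (n ∷ k ∷ []) x)

thresholdRow : Baire → Baire → ℕ → Baire
thresholdRow x t n = (t n ∷ []) ++ˢ join (column n x)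

-- The matrix is witnessed by the instance itself, so the thresholds are the only real choice.
-- Columns below a threshold are filled in too, which avoids a case distinction on `t`.
thresholdWitness : Baire → Baire → Baire
thresholdWitness x t = join (thresholdRow x t)

thresholdWitness-correct : ∀ {x t} → Thresholds x t → Witness Φ [] x (thresholdWitness x t)
thresholdWitness-correct {x} {t} h n k k≥ b =
  (λ i → trans (row-join (thresholdRow x t) n (suc (pair k (pair b i))))
        (trans (row-join (column n x) k (pair b i)) (row-join (block (n ∷ k ∷ []) x) b i))) ,
  h n k b (subst (_≤ k) (row-join (thresholdRow x t) n 0) k≥)

thresholdWitness-agree : ∀ {l x x′ t t′} → Agree l x x′ → Agree l t t′ →
                         Agree l (thresholdWitness x t) (thresholdWitness x′ t′)
thresholdWitness-agree x~x′ t~t′ =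
  join-agree λ n n<l → cons-agree (t~t′ n n<l)
    (join-agree λ k _ → join-agree λ b _ → ++ˢ-agree (n ∷ k ∷ b ∷ []) x~x′)

Good : Baire → ℕ → Set
Good y k = ∀ b → y (pair k b) ≡ 0

goodRow : Baire → Baire → ℕ → Baire
goodRow y κ m = (κ m ∷ []) ++ˢ join (block (κ m ∷ []) y)

goodWitness : Baire → Baire → Baire
goodWitness y κ = join (goodRow y κ)

goodWitness-correct : ∀ {y κ} → (∀ m → m ≤ κ m × Good y (κ m)) →
                      Witness Ψ [] y (goodWitness y κ)
goodWitness-correct {y} {κ} h m rewrite row-join (goodRow y κ) m 0 =
  proj₁ (h m) ,
  λ b → (λ i → trans (row-join (goodRow y κ) m (suc (pair b i)))
                     (row-join (block (κ m ∷ []) y) b i)) ,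
        proj₂ (h m) b

goodWitness-agree : ∀ {l y y′ κ κ′} → Agree l y y′ → Agree l κ κ′ →
                    Agree l (goodWitness y κ) (goodWitness y′ κ′)
goodWitness-agree {κ = κ} {κ′} y~y′ κ~κ′ =
  join-agree λ m m<l → cons-agree (κ~κ′ m m<l) (join-agree λ b _ → row-agree m<l b)
  where
  row-agree : ∀ {m} → m < _ → ∀ b → Agree _ ((κ m ∷ b ∷ []) ++ˢ _) ((κ′ m ∷ b ∷ []) ++ˢ _)
  row-agree m<l b rewrite κ~κ′ _ m<l = ++ˢ-agree (_ ∷ b ∷ []) y~y′

-- Instances with at most one nonzero entry

zeros : Baire
zeros = const 0

-- Recursion makes `δ (suc p)` a shift of `δ p`, so that computability follows by induction on `p`.
δ : ℕ → Baire
δ zero    zero    = 1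
δ zero    (suc i) = 0
δ (suc p) zero    = 0
δ (suc p) (suc i) = δ p i

δ-diagonal : ∀ p → δ p p ≡ 1
δ-diagonal zero    = refl
δ-diagonal (suc p) = δ-diagonal p

δ-off-diagonal : ∀ {p i} → p ≢ i → δ p i ≡ 0
δ-off-diagonal {zero}  {zero}  p≢i = contradiction refl p≢i
δ-off-diagonal {zero}  {suc i} p≢i = refl
δ-off-diagonal {suc p} {zero}  p≢i = refl
δ-off-diagonal {suc p} {suc i} p≢i = δ-off-diagonal (p≢i ∘ cong suc)

zeros-δ-agree : ∀ {l p} → l ≤ p → Agree l zeros (δ p)
zeros-δ-agree l≤p i i<l = sym (δ-off-diagonal (≢-sym (<⇒≢ (<-≤-trans i<l l≤p))))

-- The only nonzero entry sits in column `c` of row `a`, which lies before the threshold of that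
-- row.
δ-thresholds : ∀ a c b {t} → c < t a → Thresholds (δ (position a c b)) t
δ-thresholds a c b {t} c<ta n k b′ tn≤k = δ-off-diagonal distinct
  where
  distinct : position a c b ≢ position n k b′
  distinct e with pair-injective a (pair c b) n (pair k b′) e
  ... | refl , e′ with refl ← proj₁ (pair-injective c b k b′ e′) = <⇒≱ c<ta tn≤k

-- Computability of the instances

constᶜ : ∀ {o} → ℕ → Code o 0
constᶜ zero    = zeroᶜ
constᶜ (suc n) = comp sucᶜ (constᶜ n ∷ [])

constᶜ-⇓ : ∀ {o} {O : Vec Baire o} n → O ⊢ constᶜ n ∙ [] ⇓ n
constᶜ-⇓ zero    = ⇓zero
constᶜ-⇓ (suc n) = ⇓comp (⇓∷ (constᶜ-⇓ n) ⇓[]) ⇓suc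

-- Primitive recursion serves as a case distinction: the base returns `y 0`, the step runs `c` on
-- the predecessor.
computable-cons : ∀ n {x y} → y 0 ≡ n → Computable x → x ≗ tail y → Computable y
computable-cons _ {x} {y} refl (c , d) x≗ = prec (constᶜ (y 0)) (comp c (proj zero ∷ [])) , run
  where
  run : prec (constᶜ (y 0)) (comp c (proj zero ∷ [])) ⟨ [] ⟩≃ y
  run zero    = ⇓prec₀ (constᶜ-⇓ (y 0))
  run (suc i) = ⇓precₛ (run i)
    (⇓comp (⇓∷ ⇓proj ⇓[]) (subst ([] ⊢ c ∙ i ∷ [] ⇓_) (x≗ i) (d i)))

zeros-computable : Computable zeros
zeros-computable = zeroᶜ , λ _ → ⇓zero

δ-computable : ∀ p → Computable (δ p)
δ-computable zero    = computable-cons 1 refl zeros-computable λ _ → refl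
δ-computable (suc p) = computable-cons 0 refl (δ-computable p) λ _ → refl

-- Finite prefixes of sequences

++ˢ-length : ∀ {n} (ns : Vec ℕ n) x → (ns ++ˢ x) n ≡ x 0
++ˢ-length []       x = refl
++ˢ-length (_ ∷ ns) x = ++ˢ-length ns x

++ˢ-∷ʳ : ∀ {n} (ns : Vec ℕ n) m x → (ns ∷ʳ m) ++ˢ x ≗ ns ++ˢ ((m ∷ []) ++ˢ x)
++ˢ-∷ʳ []       m x i       = refl
++ˢ-∷ʳ (_ ∷ ns) m x zero    = refl
++ˢ-∷ʳ (_ ∷ ns) m x (suc i) = ++ˢ-∷ʳ ns m x i

++ˢ-mono : ∀ {n} (ns : Vec ℕ n) {x y} → (∀ i → x i ≤ y i) → ∀ i → (ns ++ˢ x) i ≤ (ns ++ˢ y) i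
++ˢ-mono []       h i       = h i
++ˢ-mono (_ ∷ ns) h zero    = ≤-refl
++ˢ-mono (_ ∷ ns) h (suc i) = ++ˢ-mono ns h i

prefix-agree : ∀ (prefix : ∀ n → Vec ℕ n) (t : Baire) →
               (∀ n → prefix (suc n) ≡ prefix n ∷ʳ t n) →
               ∀ n x → Agree n t (prefix n ++ˢ x)
prefix-agree prefix t step (suc n) x i i<1+n
  rewrite step n | ++ˢ-∷ʳ (prefix n) (t n) x i with m≤n⇒m<n∨m≡n (s≤s⁻¹ i<1+n)
... | inj₁ i<n  = prefix-agree prefix t step n _ i i<n
... | inj₂ refl = sym (++ˢ-length (prefix n) _)

-- Refuting a given reduction

module _ (em : ExcludedMiddle 0ℓ) (reduction : Φ ≤ₘ Ψ) where
  open _≤ₘ_ reduction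

  image : ∀ {x} → Computable x → Baire
  image c = proj₁ (reduces _ c)

  η-image : ∀ {x} (c : Computable x) → η ⟨ x ∷ [] ⟩≃ image c
  η-image c = proj₁ (proj₂ (reduces _ c))

  forward : ∀ {x} (c : Computable x) α → Witness Φ [] x α →
            ∃[ β ] r₋ ⟨ α ∷ x ∷ [] ⟩≃ β × Witness Ψ [] (image c) β
  forward c = proj₁ (proj₂ (proj₂ (proj₂ (reduces _ c))))

  backward : ∀ {x} (c : Computable x) α → Witness Ψ [] (image c) α →
             ∃[ β ] r₊ ⟨ α ∷ x ∷ [] ⟩≃ β × Witness Φ [] x β
  backward c = proj₂ (proj₂ (proj₂ (proj₂ (reduces _ c))))

  y₀ : Baire
  y₀ = image zeros-computable

  yδ : ℕ → Baire
  yδ p = image (δ-computable p)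

  -- Continuity of `η` at `zeros`, to which the instances `δ p` converge.
  yδ-converges : ∀ l → Eventually (λ p → Agree l y₀ (yδ p))
  yδ-converges l = eventually-∀< l λ i _ →
    let l′ , h = ≃-continuous (η-image zeros-computable) i
    in l′ , λ p l′≤p → h l′ ≤-refl _ (zeros-δ-agree l′≤p ∷ []) (η-image (δ-computable p))

  -- The condition `c < t a` says exactly that `t` still gives valid thresholds for `δ p`.
  SurvivesBelow : Baire → ℕ → ℕ → Set
  SurvivesBelow t k p = ∀ a c b → p ≡ position a c b → c < t a → Good (yδ p) k

  GoodFor : ∀ {n} → Vec ℕ n → ℕ → Set
  GoodFor σ k = Good y₀ k × (∀ N → Eventually (SurvivesBelow (σ ++ˢ const N) k))

  ¬infinitely-many-good : ∀ n → ¬ (∀ j → ∃[ k ] j ≤ k × ∃[ σ ] GoodFor {n} σ k)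
  ¬infinitely-many-good n large = contradiction
    (trans (sym (δ-diagonal p)) (proj₂ (α′-witness n u (≤-reflexive (sym u-stable)) b))) λ ()
    where
    κ : Baire
    κ j = proj₁ (large j)

    κ-survives : ∀ j N → Eventually (SurvivesBelow (proj₁ (proj₂ (proj₂ (large j))) ++ˢ const N) (κ j))
    κ-survives j = proj₂ (proj₂ (proj₂ (proj₂ (large j))))

    α = backward zeros-computable (goodWitness y₀ κ) (goodWitness-correct λ j →
          proj₁ (proj₂ (large j)) , proj₁ (proj₂ (proj₂ (proj₂ (large j)))))

    -- Position `pair n 0` holds the head of row `n`, the threshold that `r₊` announces there.
    u : ℕ
    u = proj₁ α (pair n 0)

    use = ≃-continuous (proj₁ (proj₂ α)) (pair n 0)

    l : ℕ
    l = proj₁ use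

    -- Since `σ` has length `n`, the constant `suc u` governs row `n` and just admits column `u`.
    late : Eventually (λ p → Agree l zeros (δ p) × Agree l y₀ (yδ p) ×
             (∀ j → j < l → SurvivesBelow (proj₁ (proj₂ (proj₂ (large j))) ++ˢ const (suc u)) (κ j) p))
    late = eventually-zip _,_ (l , λ p → zeros-δ-agree)
             (eventually-zip _,_ (yδ-converges l) (eventually-∀< l λ j _ → κ-survives j (suc u)))

    b p : ℕ
    -- The bound itself can serve as `b`, because a code is at least its second coordinate, hence
    -- `b ≤ p`.
    b = proj₁ late
    p = position n u b

    late-p = proj₂ late p (≤-trans (m≤n+m b (triangle (u + b))) (m≤n+m (pair u b) (triangle (n + pair u b))))

    κ-good : ∀ j → j < l → Good (yδ p) (κ j)
    κ-good j j<l = proj₂ (proj₂ late-p) j j<l n u b refl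
      (≤-reflexive (sym (++ˢ-length (proj₁ (proj₂ (proj₂ (large j)))) (const (suc u)))))

    β = forward (δ-computable p) (thresholdWitness (δ p) (const (suc u)))
          (thresholdWitness-correct {t = const (suc u)} (δ-thresholds n u b {const (suc u)} ≤-refl))

    -- Beyond l the numbers κ j may fail for δ p; any witness for η (δ p) replaces them.
    κ′ : Baire
    κ′ j with j <? l
    ... | yes _ = κ j
    ... | no _  = head (row (proj₁ β) j)

    κ-agree : Agree l κ κ′
    κ-agree j j<l with j <? l
    ... | yes _  = refl
    ... | no j≮l = contradiction j<l j≮l

    κ′-good : ∀ j → j ≤ κ′ j × Good (yδ p) (κ′ j)
    κ′-good j with j <? l
    ... | yes j<l = proj₁ (proj₂ (large j)) , κ-good j j<l
    ... | no _    = proj₁ (proj₂ (proj₂ β) j) , λ b → proj₂ (proj₂ (proj₂ (proj₂ β) j) b)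

    α′ = backward (δ-computable p) (goodWitness (yδ p) κ′) (goodWitness-correct κ′-good)

    α′-witness : Witness Φ [] (δ p) (proj₁ α′)
    α′-witness = proj₂ (proj₂ α′)

    u-stable : u ≡ proj₁ α′ (pair n 0)
    u-stable = proj₂ use l ≤-refl _
      (goodWitness-agree (proj₁ (proj₂ late-p)) κ-agree ∷ proj₁ late-p ∷ [])
      (proj₁ (proj₂ α′))

  NoneGoodFrom : ℕ → ∀ {n} → Vec ℕ n → Set
  NoneGoodFrom m σ = ∀ k → m ≤ k → ¬ GoodFor σ k

  ¬∀⇒∃¬ : ∀ {A : Set} {P : A → Set} → ¬ (∀ a → P a) → ∃[ a ] ¬ P a
  ¬∀⇒∃¬ ¬∀ = decidable-stable em λ ¬∃ → ¬∀ λ a → decidable-stable em λ ¬Pa → ¬∃ (a , ¬Pa)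

  -- The bound depends only on the length of `σ`, so `extend` can fix it before choosing the new
  -- entry.
  none-good-from : ∀ n → ∃[ m ] (∀ (σ : Vec ℕ n) → NoneGoodFrom m σ)
  none-good-from n =
    let m , ¬large = ¬∀⇒∃¬ (¬infinitely-many-good n)
    in m , λ σ k m≤k good → ¬large (k , m≤k , σ , good)

  -- If survival fails for `N` and `x` is at least `N`, then `σ` followed by `x` and constantly `N`
  -- dominates `σ` followed by constantly `N`. Survival below the larger sequence would give
  -- survival below the smaller one.
  ¬good-extension : ∀ {n} (σ : Vec ℕ n) k → ¬ GoodFor σ k →
                    Eventually (λ x → ¬ GoodFor (σ ∷ʳ x) k)
  ¬good-extension σ k ¬good with em {Good y₀ k}
  ... | no ¬good₀ = 0 , λ _ _ good → ¬good₀ (proj₁ good)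
  ... | yes good₀ with ¬∀⇒∃¬ (λ survives → ¬good (good₀ , survives))
  ...   | N , ¬survives = N , λ x N≤x good →
          ¬survives (eventually-map (λ s a c b p≡ c< → s a c b p≡ (≤-trans c< (bound x N≤x a)))
            (proj₂ good N))
    where
    bound : ∀ x → N ≤ x → ∀ a → (σ ++ˢ const N) a ≤ ((σ ∷ʳ x) ++ˢ const N) a
    bound x N≤x a = ≤-trans (++ˢ-mono σ below a) (≤-reflexive (sym (++ˢ-∷ʳ σ x (const N) a)))
      where
      below : ∀ i → N ≤ ((x ∷ []) ++ˢ const N) i
      below zero    = N≤x
      below (suc i) = ≤-refl

  extend : ∀ m {n} (σ : Vec ℕ n) → NoneGoodFrom m σ → ∃[ x ] NoneGoodFrom m (σ ∷ʳ x)
  extend m {n} σ none = x , none-extended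
    where
    j : ℕ
    j = proj₁ (none-good-from (suc n))

    fails : Eventually (λ x → ∀ k → k < j → m ≤ k → ¬ GoodFor (σ ∷ʳ x) k)
    fails = eventually-∀< j λ k _ → fails-at k
      where
      fails-at : ∀ k → Eventually (λ x → m ≤ k → ¬ GoodFor (σ ∷ʳ x) k)
      fails-at k with m ≤? k
      ... | yes m≤k = eventually-map const (¬good-extension σ k (none k m≤k))
      ... | no m≰k  = 0 , λ _ _ m≤k → contradiction m≤k m≰k

    x : ℕ
    x = proj₁ fails

    none-extended : NoneGoodFrom m (σ ∷ʳ x)
    none-extended k m≤k =
      [ (λ k<j → proj₂ fails x ≤-refl k k<j m≤k)
      , proj₂ (none-good-from (suc n)) (σ ∷ʳ x) k ]′ (<-≤-connex k j)

  good-for-prefix : ∀ (t : Baire) (prefix : ∀ n → Vec ℕ n) →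
                    (∀ n x → Agree n t (prefix n ++ˢ x)) →
                    ∀ m → ∃[ n ] ∃[ k ] m ≤ k × GoodFor (prefix n) k
  good-for-prefix t prefix t~ m =
    l , k , proj₁ (proj₂ (proj₂ β) m) , (λ b → proj₂ (proj₂ (proj₂ (proj₂ β) m) b)) , survives
    where
    β = forward zeros-computable (thresholdWitness zeros t)
          (thresholdWitness-correct {t = t} λ _ _ _ _ → refl)

    k : ℕ
    k = head (row (proj₁ β) m)

    use = ≃-continuous (proj₁ (proj₂ β)) (pair m 0)

    l : ℕ
    l = proj₁ use

    -- The prefix length is the use `l` of `r₋`: replacing `t` by `N` beyond `l`, and `zeros` by a
    -- late `δ p`, leaves the output `k` unchanged.
    survives : ∀ N → Eventually (SurvivesBelow (prefix l ++ˢ const N) k)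
    survives N = l , go
      where
      go : ∀ p → l ≤ p → SurvivesBelow (prefix l ++ˢ const N) k p
      go p l≤p a c b refl c<t = subst (Good (yδ p)) (sym k≡k′)
        λ b → proj₂ (proj₂ (proj₂ (proj₂ β′) m) b)
        where
        t′ : Baire
        t′ = prefix l ++ˢ const N

        β′ = forward (δ-computable p) (thresholdWitness (δ p) t′)
               (thresholdWitness-correct (δ-thresholds a c b {t′} c<t))

        k≡k′ : k ≡ head (row (proj₁ β′) m)
        k≡k′ = proj₂ use l ≤-refl _
          (thresholdWitness-agree (zeros-δ-agree l≤p) (t~ l (const N)) ∷ zeros-δ-agree l≤p ∷ [])
          (proj₁ (proj₂ β′))

  irreducible : ⊥
  irreducible =
    let n , k , m≤k , good = good-for-prefix t prefix (prefix-agree prefix t λ _ → refl) m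
    in proj₂ (stage n) k m≤k good
    where
    m : ℕ
    m = proj₁ (none-good-from 0)

    stage : ∀ n → ∃[ σ ] NoneGoodFrom m {n} σ
    stage zero    = [] , proj₂ (none-good-from 0) []
    stage (suc n) =
      let σ , none = stage n ; x , none′ = extend m σ none in σ ∷ʳ x , none′

    prefix : ∀ n → Vec ℕ n
    prefix n = proj₁ (stage n)

    t : Baire
    -- This is the entry that `stage (suc n)` appends, so the prefixes cohere by `refl`.
    t n = proj₁ (extend m (prefix n) (proj₂ (stage n)))

theorem4p14 : ExcludedMiddle 0ℓ → ¬ (⟨ ∀′ ∷ ∀^∞ ∷ ∀′ ∷ [] ⟩ ≤ₘ ⟨ ∃^∞ ∷ ∀′ ∷ [] ⟩)
theorem4p14 em reduction = irreducible em reduction
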